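{- Let $\mathcal X,\mathcal Y_1,\mathcal Y_2,\mathcal W$ be finite nonempty sets and $g:\mathcal W\times\mathcal X\to[0,1]$ a gain function. For any prior $\pi$ on $\mathcal X$ with $V_g(\pi)>0$ and any two channels $(\mathcal X,\mathcal Y_1,C_1)$ and $(\mathcal X,\mathcal Y_2,C_2)$, $$H_g(\pi,C_1\parallel C_2)\ \ge\ H_g(\pi,C_1)+H_g(\pi,C_2)-H_g^{\min}(\pi).$$
   Context: A (discrete) channel $(\mathcal X,\mathcal Y,C)$ consists of finite sets $\mathcal X,\mathcal Y$ and a matrix $C$ with entries $C[x,y]\ge 0$ and $\sum_{y}C[x,y]=1$ for each $x$. A prior on $\mathcal X$ is a probability distribution on $\mathcal X$. The parallel composition with shared input $C_1\parallel C_2$ is the channel from $\mathcal X$ to $\mathcal Y_1\times\mathcal Y_2$ with $(C_1\parallel C_2)[x,(y_1,y_2)]=C_1[x,y_1]\,C_2[x,y_2]$. $V_g(\pi)=\max_{w\in\mathcal W}\sum_{x}\pi[x]g(w,x)$, $V_g(\pi,C)=\sum_{y}\max_{w\in\mathcal W}\sum_x\pi[x]C[x,y]g(w,x)$, and $H_g(\pi,C)=-\log V_g(\pi,C)$. Logarithms are to base 2. $H_g^{\min}(\pi)=-\log\min\{\pi[x]g(w,x): x\in\mathcal X,\ w\in\mathcal W,\ \pi[x]g(w,x)\ne0\}$. -}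

module Defs where

open import Level using (Level) renaming (suc to lsuc)
open import Algebra.Bundles using (CommutativeRing; Semiring)
open import Algebra.Structures using (IsCommutativeRing)
open import Data.List.Base using (List; []; _∷_; _++_; map; foldr; filter; cartesianProduct)
open import Data.List.Membership.Propositional using (_∈_)
open import Data.List.Membership.Propositional.Properties using (∈-cartesianProduct⁺)
open import Data.List.Relation.Unary.Unique.Propositional using (Unique)
open import Data.List.Relation.Unary.Unique.Propositional.Properties using (cartesianProduct⁺)
import Data.List.Extrema as Extrema
open import Data.Nat.Base using (ℕ; suc)
open import Data.Product.Base using (Σ; ∃; _×_; _,_)
open import Relation.Binary.Bundles using (DecTotalOrder)
open import Relation.Binary.Core using (Rel)
open import Relation.Binary.Structures using (IsDecTotalOrder)
import Relation.Binary.Construct.NonStrictToStrict as ToStrict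
import Relation.Binary.Reasoning.Setoid as SetoidReasoning
open import Relation.Nullary using (¬_)
open import Relation.Nullary.Decidable using (¬?)
open import Relation.Unary using (Pred; Satisfiable)

-- The real numbers, given by the axioms that determine them up to isomorphism.
-- The order is that of classical analysis, hence total and decidable.
-- `sup` is total for convenience: nothing is assumed of its value on a set
-- that is empty or unbounded above.
record CompleteOrderedField (ℓ : Level) : Set (lsuc ℓ) where
  infix  4 _≈_ _≤_ _≥_
  infix  8 -_
  infixl 7 _*_
  infixl 6 _+_ _-_
  field
    Carrier : Set ℓ
    _≈_ _≤_ : Rel Carrier ℓ
    _+_ _*_ : Carrier → Carrier → Carrier
    -_      : Carrier → Carrier
    0# 1#   : Carrier

    isCommutativeRing : IsCommutativeRing _≈_ _+_ _*_ -_ 0# 1#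
    0≉1               : ¬ 0# ≈ 1#
    inverse           : ∀ {x} → ¬ x ≈ 0# → ∃ λ y → x * y ≈ 1#

    isDecTotalOrder   : IsDecTotalOrder _≈_ _≤_
    +-monoˡ-≤         : ∀ z {x y} → x ≤ y → x + z ≤ y + z
    *-nonNegative     : ∀ {x y} → 0# ≤ x → 0# ≤ y → 0# ≤ x * y

  UpperBound : Pred Carrier ℓ → Pred Carrier ℓ
  UpperBound P u = ∀ {x} → P x → x ≤ u

  LeastUpperBound : Pred Carrier ℓ → Pred Carrier ℓ
  LeastUpperBound P s = UpperBound P s × (∀ {u} → UpperBound P u → s ≤ u)

  field
    sup   : Pred Carrier ℓ → Carrier
    isSup : ∀ P → Satisfiable P → Satisfiable (UpperBound P) → LeastUpperBound P (sup P)

  commutativeRing : CommutativeRing ℓ ℓ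
  commutativeRing = record { isCommutativeRing = isCommutativeRing }

  decTotalOrder : DecTotalOrder ℓ ℓ ℓ
  decTotalOrder = record { isDecTotalOrder = isDecTotalOrder }

  open IsDecTotalOrder isDecTotalOrder public using (_≟_; _≤?_)
  open ToStrict _≈_ _≤_ public using (_<_)

  _≥_ : Rel Carrier ℓ
  x ≥ y = y ≤ x

  _-_ : Carrier → Carrier → Carrier
  x - y = x + (- y)

-- Finite sets, listed without repetition.
record FiniteSet : Set₁ where
  field
    ∣_∣      : Set
    elements : List ∣_∣
    unique   : Unique elements
    complete : ∀ x → x ∈ elements

open FiniteSet public using (∣_∣; elements)

Nonempty : FiniteSet → Set
Nonempty X = ∣ X ∣

infixr 2 _×ᶠ_
_×ᶠ_ : FiniteSet → FiniteSet → FiniteSet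
X ×ᶠ Y = record
  { ∣_∣      = ∣ X ∣ × ∣ Y ∣
  ; elements = cartesianProduct (elements X) (elements Y)
  ; unique   = cartesianProduct⁺ (FiniteSet.unique X) (FiniteSet.unique Y)
  ; complete = λ (x , y) → ∈-cartesianProduct⁺ (FiniteSet.complete X x) (FiniteSet.complete Y y)
  }

module Leakage {ℓ} (ℝ : CompleteOrderedField ℓ) where

  open CompleteOrderedField ℝ
  private
    module R = CommutativeRing commutativeRing
    module O = DecTotalOrder decTotalOrder

  open import Algebra.Definitions.RawSemiring (Semiring.rawSemiring R.semiring) public
    using (_^_) renaming (_×_ to _·_)

  2# : Carrier
  2# = 1# + 1#

  -- For x > 0, log₂ x is the supremum of the rationals r = (a ∸ b) / (1 + q)
  -- (a, b, q natural, the subtraction being that of the integers) with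
  -- 2 ^ r ≤ x.  Denominators are cleared in both conditions.  The value is
  -- unspecified for x ≤ 0.
  2^-≤ : Carrier → Pred Carrier ℓ
  2^-≤ x r = Σ ℕ λ a → Σ ℕ λ b → Σ ℕ λ q →
    (suc q · r + b · 1# ≈ a · 1#) × (2# ^ a ≤ 2# ^ b * x ^ suc q)

  log₂ : Carrier → Carrier
  log₂ x = sup (2^-≤ x)

  sumList : List Carrier → Carrier
  sumList = foldr _+_ 0#

  -- The value 0# on the empty list is arbitrary.
  maximum : List Carrier → Carrier
  maximum []       = 0#
  maximum (v ∷ vs) = Extrema.max O.totalOrder v vs

  minimum : List Carrier → Carrier
  minimum []       = 0#
  minimum (v ∷ vs) = Extrema.min O.totalOrder v vs

  sumOver : (X : FiniteSet) → (∣ X ∣ → Carrier) → Carrier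
  sumOver X f = sumList (map f (elements X))

  maxOver : (X : FiniteSet) → (∣ X ∣ → Carrier) → Carrier
  maxOver X f = maximum (map f (elements X))

  infixr 5 sumOver maxOver
  syntax sumOver X (λ x → e) = ∑[ x ∈ X ] e
  syntax maxOver X (λ x → e) = max[ x ∈ X ] e

  record Distribution (X : FiniteSet) : Set ℓ where
    infix 9 _[_]
    field
      _[_]        : ∣ X ∣ → Carrier
      nonNegative : ∀ x → 0# ≤ _[_] x
      sum≈1       : ∑[ x ∈ X ] _[_] x ≈ 1#

  open Distribution public using (_[_])

  Prior : FiniteSet → Set ℓ
  Prior = Distribution

  record Channel (X Y : FiniteSet) : Set ℓ where
    field
      matrix      : ∣ X ∣ → ∣ Y ∣ → Carrier
      nonNegative : ∀ x y → 0# ≤ matrix x y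
      rowSum≈1    : ∀ x → ∑[ y ∈ Y ] matrix x y ≈ 1#

  open Channel public using (matrix)

  record GainFunction (W X : FiniteSet) : Set ℓ where
    field
      gain        : ∣ W ∣ → ∣ X ∣ → Carrier
      nonNegative : ∀ w x → 0# ≤ gain w x
      ≤1          : ∀ w x → gain w x ≤ 1#

  open GainFunction public using (gain)

  private
    open SetoidReasoning R.setoid

    sumList-map-++ : ∀ {A : Set} (f : A → Carrier) xs ys →
      sumList (map f (xs ++ ys)) ≈ sumList (map f xs) + sumList (map f ys)
    sumList-map-++ f []       ys = R.sym (R.+-identityˡ _)
    sumList-map-++ f (x ∷ xs) ys =
      R.trans (R.+-congˡ (sumList-map-++ f xs ys)) (R.sym (R.+-assoc _ _ _))

    sumList-row : ∀ {A B : Set} (f : A → Carrier) (g : B → Carrier) x ys →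
      sumList (map (λ (x , y) → f x * g y) (map (x ,_) ys)) ≈ f x * sumList (map g ys)
    sumList-row f g x []       = R.sym (R.zeroʳ _)
    sumList-row f g x (y ∷ ys) =
      R.trans (R.+-congˡ (sumList-row f g x ys)) (R.sym (R.distribˡ _ _ _))

    sumList-product : ∀ {A B : Set} (f : A → Carrier) (g : B → Carrier) xs ys →
      sumList (map (λ (x , y) → f x * g y) (cartesianProduct xs ys))
        ≈ sumList (map f xs) * sumList (map g ys)
    sumList-product f g []       ys = R.sym (R.zeroˡ _)
    sumList-product f g (x ∷ xs) ys = begin
      sumList (map h (map (x ,_) ys ++ cartesianProduct xs ys))
        ≈⟨ sumList-map-++ h (map (x ,_) ys) _ ⟩
      sumList (map h (map (x ,_) ys)) + sumList (map h (cartesianProduct xs ys))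
        ≈⟨ R.+-cong (sumList-row f g x ys) (sumList-product f g xs ys) ⟩
      f x * sumList (map g ys) + sumList (map f xs) * sumList (map g ys)
        ≈⟨ R.distribʳ _ _ _ ⟨
      (f x + sumList (map f xs)) * sumList (map g ys) ∎
      where h = λ (x , y) → f x * g y

  infixr 7 _∥_
  _∥_ : ∀ {X Y₁ Y₂} → Channel X Y₁ → Channel X Y₂ → Channel X (Y₁ ×ᶠ Y₂)
  _∥_ {X} {Y₁} {Y₂} C₁ C₂ = record
    { matrix      = λ x (y₁ , y₂) → matrix C₁ x y₁ * matrix C₂ x y₂
    ; nonNegative = λ x (y₁ , y₂) →
        *-nonNegative (Channel.nonNegative C₁ x y₁) (Channel.nonNegative C₂ x y₂)
    ; rowSum≈1    = λ x → begin
        sumOver (Y₁ ×ᶠ Y₂) (λ (y₁ , y₂) → matrix C₁ x y₁ * matrix C₂ x y₂)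
          ≈⟨ sumList-product (matrix C₁ x) (matrix C₂ x) (elements Y₁) (elements Y₂) ⟩
        sumOver Y₁ (matrix C₁ x) * sumOver Y₂ (matrix C₂ x)
          ≈⟨ R.*-cong (Channel.rowSum≈1 C₁ x) (Channel.rowSum≈1 C₂ x) ⟩
        1# * 1#
          ≈⟨ R.*-identityˡ 1# ⟩
        1# ∎
    }

  module _ {W X : FiniteSet} (g : GainFunction W X) (π : Prior X) where

    priorV : Carrier
    priorV = max[ w ∈ W ] ∑[ x ∈ X ] π [ x ] * gain g w x

    posteriorV : ∀ {Y} → Channel X Y → Carrier
    posteriorV {Y} C = ∑[ y ∈ Y ] max[ w ∈ W ] ∑[ x ∈ X ] π [ x ] * matrix C x y * gain g w x

    posteriorH : ∀ {Y} → Channel X Y → Carrier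
    posteriorH C = - log₂ (posteriorV C)

    minH : Carrier
    minH = - log₂ (minimum (filter (λ v → ¬? (v ≟ 0#))
      (map (λ (x , w) → π [ x ] * gain g w x) (elements (X ×ᶠ W)))))

{-# OPTIONS --safe #-}

-- Let m be the least nonzero value of π[x] g(w,x).  Every such value v satisfies
-- m v ≤ v², so for fixed y₁, y₂, w
--   m ∑ₓ π C₁ C₂ g ≤ ∑ₓ (π C₁ g)(π C₂ g) ≤ (∑ₓ π C₁ g)(∑ₓ π C₂ g),
-- the second step by discarding nonnegative cross terms.  Taking the maximum over w and
-- summing over y₁, y₂ gives m V(π, C₁ ∥ C₂) ≤ V(π, C₁) V(π, C₂); now take logarithms,
-- all arguments being positive since V(π, C) ≥ V(π) > 0.
--
-- Constructively the Archimedean property and its consequences only hold up to double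
-- negation.  This suffices because the order of the reals is decidable.

module Submission where

open import Algebra.Bundles using (CommutativeRing)
import Algebra.Properties.AbelianGroup as AbelianGroupProperties
import Algebra.Properties.CommutativeSemiring.Exp as Exp
import Algebra.Properties.Monoid.Mult as MonoidMult
import Algebra.Properties.Ring as RingProperties
import Algebra.Properties.Semiring.Mult as SemiringMult
import Algebra.Solver.Ring.NaturalCoefficients.Default as SemiringSolver
open import Data.Empty using (⊥-elim)
import Data.List.Extrema as Extrema
open import Data.List.Base using (List; []; _∷_; _++_; map; filter; cartesianProduct)
open import Data.List.Membership.Propositional using (_∈_)
open import Data.List.Membership.Propositional.Properties using (∈-map⁺; ∈-filter⁺)
open import Data.List.Relation.Unary.All as All using (All; []; _∷_)
import Data.List.Relation.Unary.All.Properties as All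
open import Data.List.Relation.Unary.Any using (here; there)
open import Data.Nat.Base as ℕ using (ℕ; zero; suc)
import Data.Nat.Properties as ℕ
open import Data.Product.Base using (∃; ∃₂; _×_; _,_; proj₁; proj₂)
open import Data.Sum.Base using (inj₁; inj₂)
open import Function.Base using (_∘_)
open import Relation.Binary.Bundles using (DecTotalOrder)
import Relation.Binary.Properties.DecTotalOrder as DecTotalOrderProperties
import Relation.Binary.Reasoning.PartialOrder as PartialOrderReasoning
open import Relation.Binary.PropositionalEquality as ≡ using (_≡_)
open import Relation.Nullary using (¬_; yes; no; contradiction)
open import Relation.Nullary.Decidable using (¬?; decidable-stable)
open import Relation.Unary using (Pred; Decidable)

open import Defs

-- The search runs downward from `k` and stops at the first `c` that satisfies `P`. It serves to
-- locate a real number between two consecutive powers of two.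
switch-point : ∀ {p} {P : Pred ℕ p} → Decidable P → P 0 → ∀ k → ¬ P k →
  ∃ λ c → P c × ¬ P (suc c)
switch-point P? P0 zero    ¬Pk = ⊥-elim (¬Pk P0)
switch-point P? P0 (suc k) ¬Pk with P? k
... | yes Pk = k , Pk , ¬Pk
... | no ¬Pk′ = switch-point P? P0 k ¬Pk′

-- Arithmetic in an ordered field.

module OrderedField {ℓ} (ℝ : CompleteOrderedField ℓ) where
  open CompleteOrderedField ℝ
  open Leakage ℝ using (_^_; _·_; 2#)
  module R = CommutativeRing commutativeRing
  module O = DecTotalOrder decTotalOrder
  open R using (+-cong; +-congˡ; +-congʳ; *-congˡ; *-congʳ)
  open RingProperties R.ring using (x[y-z]≈xy-xz)
  open DecTotalOrderProperties decTotalOrder using (≰⇒>; <⇒≱)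
  open MonoidMult R.+-monoid using (×-homo-+)
  open SemiringMult R.semiring using (×1-homo-*)
  open SemiringSolver R.commutativeSemiring using (solve; _:=_; _:+_; _:*_; con)
  open PartialOrderReasoning O.poset

  -- Lets a proof of an inequality use witnesses that exist only up to double negation.
  ≤-stable : ∀ {x y} → ¬ ¬ x ≤ y → x ≤ y
  ≤-stable = decidable-stable (_ ≤? _)

  +-monoʳ-≤ : ∀ z {x y} → x ≤ y → z + x ≤ z + y
  +-monoʳ-≤ z {x} {y} x≤y = begin
    z + x ≈⟨ R.+-comm z x ⟩
    x + z ≤⟨ +-monoˡ-≤ z x≤y ⟩
    y + z ≈⟨ R.+-comm y z ⟩
    z + y ∎

  +-mono-≤ : ∀ {x y u v} → x ≤ y → u ≤ v → x + u ≤ y + v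
  +-mono-≤ x≤y u≤v = O.trans (+-monoˡ-≤ _ x≤y) (+-monoʳ-≤ _ u≤v)

  x+y-y≈x : ∀ x y → (x + y) - y ≈ x
  x+y-y≈x x y = begin-equality
    (x + y) - y   ≈⟨ R.+-assoc x y (- y) ⟩
    x + (y - y)   ≈⟨ +-congˡ (R.-‿inverseʳ y) ⟩
    x + 0#        ≈⟨ R.+-identityʳ x ⟩
    x             ∎

  x-y+y≈x : ∀ x y → (x - y) + y ≈ x
  x-y+y≈x x y = begin-equality
    (x - y) + y     ≈⟨ R.+-assoc x (- y) y ⟩
    x + (- y + y)   ≈⟨ +-congˡ (R.-‿inverseˡ y) ⟩
    x + 0#          ≈⟨ R.+-identityʳ x ⟩
    x               ∎

  x+y≤z⇒x≤z-y : ∀ {x y z} → x + y ≤ z → x ≤ z - y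
  x+y≤z⇒x≤z-y {x} {y} {z} p = begin
    x            ≈⟨ x+y-y≈x x y ⟨
    (x + y) - y  ≤⟨ +-monoˡ-≤ (- y) p ⟩
    z - y        ∎

  x≤z-y⇒x+y≤z : ∀ {x y z} → x ≤ z - y → x + y ≤ z
  x≤z-y⇒x+y≤z {x} {y} {z} p = begin
    x + y        ≤⟨ +-monoˡ-≤ y p ⟩
    (z - y) + y  ≈⟨ x-y+y≈x z y ⟩
    z            ∎

  x-y≤z⇒x≤z+y : ∀ {x y z} → x - y ≤ z → x ≤ z + y
  x-y≤z⇒x≤z+y {x} {y} {z} p = begin
    x            ≈⟨ x-y+y≈x x y ⟨
    (x - y) + y  ≤⟨ +-monoˡ-≤ y p ⟩
    z + y        ∎

  x≤z+y⇒x-y≤z : ∀ {x y z} → x ≤ z + y → x - y ≤ z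
  x≤z+y⇒x-y≤z {x} {y} {z} p = begin
    x - y        ≤⟨ +-monoˡ-≤ (- y) p ⟩
    (z + y) - y  ≈⟨ x+y-y≈x z y ⟩
    z            ∎

  +-cancelʳ-≤ : ∀ z {x y} → x + z ≤ y + z → x ≤ y
  +-cancelʳ-≤ z {x} {y} p = O.trans (x+y≤z⇒x≤z-y p) (O.reflexive (x+y-y≈x y z))

  x≤y⇒0≤y-x : ∀ {x y} → x ≤ y → 0# ≤ y - x
  x≤y⇒0≤y-x {x} p = x+y≤z⇒x≤z-y (O.trans (O.reflexive (R.+-identityˡ x)) p)

  0≤y-x⇒x≤y : ∀ {x y} → 0# ≤ y - x → x ≤ y
  0≤y-x⇒x≤y {x} p = O.trans (O.reflexive (R.sym (R.+-identityˡ x))) (x≤z-y⇒x+y≤z p)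

  *-monoʳ-≤ : ∀ {z x y} → 0# ≤ z → x ≤ y → z * x ≤ z * y
  *-monoʳ-≤ {z} {x} {y} 0≤z x≤y = 0≤y-x⇒x≤y (begin
    0#             ≤⟨ *-nonNegative 0≤z (x≤y⇒0≤y-x x≤y) ⟩
    z * (y - x)    ≈⟨ x[y-z]≈xy-xz z y x ⟩
    z * y - z * x  ∎)

  *-monoˡ-≤ : ∀ {z x y} → 0# ≤ z → x ≤ y → x * z ≤ y * z
  *-monoˡ-≤ {z} {x} {y} 0≤z x≤y = begin
    x * z ≈⟨ R.*-comm x z ⟩
    z * x ≤⟨ *-monoʳ-≤ 0≤z x≤y ⟩
    z * y ≈⟨ R.*-comm z y ⟩
    y * z ∎

  *-mono-≤ : ∀ {x y u v} → 0# ≤ x → 0# ≤ v → x ≤ y → u ≤ v → x * u ≤ y * v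
  *-mono-≤ 0≤x 0≤v x≤y u≤v = O.trans (*-monoʳ-≤ 0≤x u≤v) (*-monoˡ-≤ 0≤v x≤y)

  +-nonNegative : ∀ {x y} → 0# ≤ x → 0# ≤ y → 0# ≤ x + y
  +-nonNegative {x} {y} 0≤x 0≤y = begin
    0#       ≈⟨ R.+-identityˡ 0# ⟨
    0# + 0#  ≤⟨ +-mono-≤ 0≤x 0≤y ⟩
    x + y    ∎

  -- Strictness means `≤` and not `≈`, so zero divisors must be excluded: if the product vanished,
  -- multiplying by the inverse of `y` would give `0# ≈ x`.
  *-positive : ∀ {x y} → 0# < x → 0# < y → 0# < x * y
  *-positive {x} {y} (0≤x , 0≉x) (0≤y , 0≉y) = *-nonNegative 0≤x 0≤y , λ 0≈xy →
    let (w , yw≈1) = inverse (0≉y ∘ R.sym)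
    in 0≉x (begin-equality
      0#           ≈⟨ R.zeroˡ w ⟨
      0# * w       ≈⟨ *-congʳ 0≈xy ⟩
      x * y * w    ≈⟨ R.*-assoc x y w ⟩
      x * (y * w)  ≈⟨ *-congˡ yw≈1 ⟩
      x * 1#       ≈⟨ R.*-identityʳ x ⟩
      x            ∎)

  -- Otherwise `x - y` is positive, and so is `z * (x - y)`, against the hypothesis.
  *-cancelˡ-≤ : ∀ {z x y} → 0# < z → z * x ≤ z * y → x ≤ y
  *-cancelˡ-≤ {z} {x} {y} 0<z p = ≤-stable λ x≰y →
    let (y≤x , y≉x) = ≰⇒> x≰y
        0<x-y : 0# < x - y
        0<x-y = x≤y⇒0≤y-x y≤x , λ 0≈x-y → y≉x (begin-equality
          y            ≈⟨ R.+-identityˡ y ⟨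
          0# + y       ≈⟨ +-congʳ 0≈x-y ⟩
          (x - y) + y  ≈⟨ x-y+y≈x x y ⟩
          x            ∎)
    in <⇒≱ (*-positive 0<z 0<x-y) (begin
      z * (x - y)    ≈⟨ x[y-z]≈xy-xz z x y ⟩
      z * x - z * y  ≤⟨ +-monoˡ-≤ (- (z * y)) p ⟩
      z * y - z * y  ≈⟨ R.-‿inverseʳ (z * y) ⟩
      0#             ∎)

  0<1 : 0# < 1#
  0<1 with O.total 0# 1#
  ... | inj₁ 0≤1 = 0≤1 , 0≉1
  ... | inj₂ 1≤0 = O.trans (x-y≤z⇒x≤z+y -1≤0) (O.reflexive (R.+-identityˡ 1#)) , 0≉1
    where
    -- If `1# ≤ 0#`, then -1 is nonnegative, and multiplying `1# ≤ 0#` by it gives -1 ≤ 0, hence 0 ≤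
    -- 1 after all.
    -1≤0 : 0# - 1# ≤ 0#
    -1≤0 = begin
      0# - 1#         ≈⟨ R.*-identityʳ _ ⟨
      (0# - 1#) * 1#  ≤⟨ *-monoʳ-≤ (x≤y⇒0≤y-x 1≤0) 1≤0 ⟩
      (0# - 1#) * 0#  ≈⟨ R.zeroʳ _ ⟩
      0#              ∎

  -‿anti-≤ : ∀ {x y} → x ≤ y → - y ≤ - x
  -‿anti-≤ {x} {y} x≤y = begin
    - y          ≈⟨ R.+-identityˡ (- y) ⟨
    0# - y       ≤⟨ x≤z+y⇒x-y≤z (begin
      0#           ≤⟨ x≤y⇒0≤y-x x≤y ⟩
      y - x        ≈⟨ R.+-comm y (- x) ⟩
      - x + y      ∎) ⟩
    - x          ∎

  -- Natural numbers in the field and the Archimedean property.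

  ι : ℕ → Carrier
  ι n = n · 1#

  ι-nonNegative : ∀ n → 0# ≤ ι n
  ι-nonNegative zero    = O.refl
  ι-nonNegative (suc n) = +-nonNegative (proj₁ 0<1) (ι-nonNegative n)

  ι-positive : ∀ n → 0# < ι (suc n)
  ι-positive n = ι-nonNegative (suc n) , λ 0≈ι → <⇒≱ 0<1 (begin
    1#          ≈⟨ R.+-identityʳ 1# ⟨
    1# + 0#     ≤⟨ +-monoʳ-≤ 1# (ι-nonNegative n) ⟩
    ι (suc n)   ≈⟨ 0≈ι ⟨
    0#          ∎)

  ι-homo-+ : ∀ m n → ι (m ℕ.+ n) ≈ ι m + ι n
  ι-homo-+ = ×-homo-+ 1#

  ι-homo-* : ∀ m n → ι (m ℕ.* n) ≈ ι m * ι n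
  ι-homo-* = ×1-homo-*

  ι-mono-≤ : ∀ {m n} → m ℕ.≤ n → ι m ≤ ι n
  ι-mono-≤ {n = n} ℕ.z≤n = ι-nonNegative n
  ι-mono-≤ (ℕ.s≤s m≤n)   = +-monoʳ-≤ 1# (ι-mono-≤ m≤n)

  ·≈ι* : ∀ n x → n · x ≈ ι n * x
  ·≈ι* zero    x = R.sym (R.zeroˡ x)
  ·≈ι* (suc n) x = begin-equality
    x + n · x          ≈⟨ +-cong (R.sym (R.*-identityˡ x)) (·≈ι* n x) ⟩
    1# * x + ι n * x   ≈⟨ R.distribʳ x 1# (ι n) ⟨
    ι (suc n) * x      ∎

  -- If the supremum s of the multiples of z exists, then s - z is also an upper bound.
  bounded-multiples : ∀ {z u} → (∀ n → suc n · z ≤ u) → z ≤ 0#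
  bounded-multiples {z} {u} bound = +-cancelʳ-≤ s (begin
    z + s         ≈⟨ R.+-comm z s ⟩
    s + z         ≤⟨ x≤z-y⇒x+y≤z (least λ { (n , eq) → O.trans (O.reflexive eq) (x+y≤z⇒x≤z-y (begin
      suc n · z + z    ≈⟨ R.+-comm _ z ⟩
      suc (suc n) · z  ≤⟨ upper (suc n , R.refl) ⟩
      s                ∎)) }) ⟩
    s             ≈⟨ R.+-identityˡ s ⟨
    0# + s        ∎)
    where
    Multiple : Pred Carrier ℓ
    Multiple y = ∃ λ n → y ≈ suc n · z
    s : Carrier
    s = sup Multiple
    lub : LeastUpperBound Multiple s
    lub = isSup Multiple (_ , 0 , R.refl) (u , λ (n , eq) → O.trans (O.reflexive eq) (bound n))
    upper : UpperBound Multiple s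
    upper = proj₁ lub
    least : ∀ {v} → UpperBound Multiple v → s ≤ v
    least = proj₂ lub

  -- If no such `n` existed, `x` would bound all multiples of `1#`, which forces `1# ≤ 0#`.
  archimedean : ∀ x → ¬ ¬ ∃ λ n → x ≤ ι n
  archimedean x ∄n = <⇒≱ 0<1 (bounded-multiples λ n → proj₁ (≰⇒> λ x≤ιn → ∄n (suc n , x≤ιn)))

  -- Powers and the growth of powers of two.

  ^-positive : ∀ {x} n → 0# < x → 0# < x ^ n
  ^-positive zero    0<x = 0<1
  ^-positive (suc n) 0<x = *-positive 0<x (^-positive n 0<x)

  ^-monoˡ-≤ : ∀ n {x y} → 0# ≤ x → x ≤ y → x ^ n ≤ y ^ n
  ^-monoˡ-≤ zero    0≤x x≤y = O.refl
  ^-monoˡ-≤ (suc n) 0≤x x≤y =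
    *-mono-≤ 0≤x (^-nonNegative n (O.trans 0≤x x≤y)) x≤y (^-monoˡ-≤ n 0≤x x≤y)
    where
    ^-nonNegative : ∀ {x} n → 0# ≤ x → 0# ≤ x ^ n
    ^-nonNegative zero    _   = proj₁ 0<1
    ^-nonNegative (suc n) 0≤x = *-nonNegative 0≤x (^-nonNegative n 0≤x)

  0<2 : 0# < 2#
  0<2 = begin-strict
    0#        <⟨ 0<1 ⟩
    1#        ≈⟨ R.+-identityʳ 1# ⟨
    1# + 0#   ≤⟨ +-monoʳ-≤ 1# (proj₁ 0<1) ⟩
    2#        ∎

  0<2^ : ∀ n → 0# < 2# ^ n
  0<2^ n = ^-positive n 0<2

  2^suc≈2^+2^ : ∀ n → 2# ^ suc n ≈ 2# ^ n + 2# ^ n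
  2^suc≈2^+2^ n = solve 1 (λ p → con 2 :* p := p :+ p) R.refl (2# ^ n)

  1≤2^ : ∀ n → 1# ≤ 2# ^ n
  1≤2^ zero    = O.refl
  1≤2^ (suc n) = begin
    1#               ≤⟨ 1≤2^ n ⟩
    2# ^ n           ≈⟨ R.+-identityʳ _ ⟨
    2# ^ n + 0#      ≤⟨ +-monoʳ-≤ _ (proj₁ (0<2^ n)) ⟩
    2# ^ n + 2# ^ n  ≈⟨ 2^suc≈2^+2^ n ⟨
    2# ^ suc n       ∎

  -- Bernoulli's inequality for base 2. With the Archimedean property it makes the powers of two
  -- unbounded.
  1+ι≤2^ : ∀ n → 1# + ι n ≤ 2# ^ n
  1+ι≤2^ zero    = O.reflexive (R.+-identityʳ 1#)
  1+ι≤2^ (suc n) = begin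
    1# + ι (suc n)   ≤⟨ +-mono-≤ (1≤2^ n) (1+ι≤2^ n) ⟩
    2# ^ n + 2# ^ n  ≈⟨ 2^suc≈2^+2^ n ⟨
    2# ^ suc n       ∎

  2^-mono-≤ : ∀ {m n} → m ℕ.≤ n → 2# ^ m ≤ 2# ^ n
  2^-mono-≤ {n = n} ℕ.z≤n = 1≤2^ n
  2^-mono-≤ (ℕ.s≤s m≤n)   = *-monoʳ-≤ (proj₁ 0<2) (2^-mono-≤ m≤n)

  -- If `n < m`, then `1# + 2# ^ n ≤ 2# ^ suc n ≤ 2# ^ m ≤ 2# ^ n`, which is absurd. This turns
  -- estimates of powers into estimates of exponents.
  2^-cancel-≤ : ∀ {m n} → 2# ^ m ≤ 2# ^ n → m ℕ.≤ n
  2^-cancel-≤ {m} {n} p = ℕ.≮⇒≥ λ n<m → <⇒≱ 0<1 (+-cancelʳ-≤ (2# ^ n) (begin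
    1# + 2# ^ n       ≤⟨ +-monoˡ-≤ (2# ^ n) (1≤2^ n) ⟩
    2# ^ n + 2# ^ n   ≈⟨ 2^suc≈2^+2^ n ⟨
    2# ^ suc n        ≤⟨ 2^-mono-≤ n<m ⟩
    2# ^ m            ≤⟨ p ⟩
    2# ^ n            ≈⟨ R.+-identityˡ _ ⟨
    0# + 2# ^ n       ∎))

  2^-unbounded : ∀ x → ¬ ¬ ∃ λ n → x < 2# ^ n
  2^-unbounded x ∄n = archimedean x λ (n , x≤ιn) → ∄n (n , (begin-strict
    x          ≤⟨ x≤ιn ⟩
    ι n        <⟨ ≰⇒> (λ 1+ιn≤ιn → <⇒≱ 0<1 (+-cancelʳ-≤ (ι n)
                    (O.trans 1+ιn≤ιn (O.reflexive (R.sym (R.+-identityˡ (ι n))))))) ⟩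
    1# + ι n   ≤⟨ 1+ι≤2^ n ⟩
    2# ^ n     ∎))

  -- Produces the rational (a - b) / (1 + n) together with the cleared-denominator equation that
  -- membership in `2^-≤` asks for.
  quotient : ∀ n a b → ∃ λ r → suc n · r + ι b ≈ ι a
  quotient n a b = r , (begin-equality
    suc n · r + ι b                  ≈⟨ +-congʳ (·≈ι* (suc n) r) ⟩
    ι (suc n) * (w * (ι a - ι b)) + ι b  ≈⟨ +-congʳ (R.*-assoc _ w _) ⟨
    ι (suc n) * w * (ι a - ι b) + ι b    ≈⟨ +-congʳ (*-congʳ nw≈1) ⟩
    1# * (ι a - ι b) + ι b               ≈⟨ +-congʳ (R.*-identityˡ _) ⟩
    (ι a - ι b) + ι b                    ≈⟨ x-y+y≈x (ι a) (ι b) ⟩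
    ι a                                  ∎)
    where
    inv : ∃ λ w → ι (suc n) * w ≈ 1#
    inv = inverse (proj₂ (ι-positive n) ∘ R.sym)
    w : Carrier
    w = proj₁ inv
    nw≈1 : ι (suc n) * w ≈ 1#
    nw≈1 = proj₂ inv
    r : Carrier
    r = w * (ι a - ι b)

-- The binary logarithm: its defining supremum and its additivity.

module Logarithm {ℓ} (ℝ : CompleteOrderedField ℓ) where
  open CompleteOrderedField ℝ
  open Leakage ℝ using (_^_; _·_; 2#; 2^-≤; log₂)
  open OrderedField ℝ
  open R using (+-cong; +-congˡ; +-congʳ; *-cong; *-congˡ; *-congʳ)
  open RingProperties R.ring using (x[y-z]≈xy-xz)
  open DecTotalOrderProperties decTotalOrder using (≰⇒>; <⇒≱)
  open Exp R.commutativeSemiring using (^-homo-*; ^-distrib-*; ^-assocʳ)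
  open SemiringSolver R.commutativeSemiring using (solve; _:=_; _:+_; _:*_)
  open PartialOrderReasoning O.poset

  -- Raising both sides to the power `m` expands the fraction (a - b) / n by `m`, which allows a
  -- change to a common denominator.
  power-bound-^ : ∀ {x} a b n m → 2# ^ a ≤ 2# ^ b * x ^ n →
    2# ^ (a ℕ.* m) ≤ 2# ^ (b ℕ.* m) * x ^ (n ℕ.* m)
  power-bound-^ {x} a b n m p = begin
    2# ^ (a ℕ.* m)                     ≈⟨ ^-assocʳ 2# a m ⟨
    (2# ^ a) ^ m                       ≤⟨ ^-monoˡ-≤ m (proj₁ (0<2^ a)) p ⟩
    (2# ^ b * x ^ n) ^ m               ≈⟨ ^-distrib-* (2# ^ b) (x ^ n) m ⟩
    (2# ^ b) ^ m * (x ^ n) ^ m         ≈⟨ *-cong (^-assocʳ 2# b m) (^-assocʳ x n m) ⟩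
    2# ^ (b ℕ.* m) * x ^ (n ℕ.* m)     ∎

  -- Multiplying the two bounds adds the fractions (a - b) / n and (c - d) / n, whose denominators
  -- already agree.
  power-bound-* : ∀ {x y} a b c d n → 2# ^ a ≤ 2# ^ b * x ^ n → 2# ^ c ≤ 2# ^ d * y ^ n →
    2# ^ (a ℕ.+ c) ≤ 2# ^ (b ℕ.+ d) * (x * y) ^ n
  power-bound-* {x} {y} a b c d n p q = begin
    2# ^ (a ℕ.+ c)                       ≈⟨ ^-homo-* 2# a c ⟩
    2# ^ a * 2# ^ c                      ≤⟨ *-mono-≤ (proj₁ (0<2^ a))
                                              (O.trans (proj₁ (0<2^ c)) q) p q ⟩
    (2# ^ b * x ^ n) * (2# ^ d * y ^ n)  ≈⟨ solve 4 (λ b x d y → (b :* x) :* (d :* y) :=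
                                              (b :* d) :* (x :* y)) R.refl _ _ _ _ ⟩
    (2# ^ b * 2# ^ d) * (x ^ n * y ^ n)  ≈⟨ *-cong (^-homo-* 2# b d) (^-distrib-* x y n) ⟨
    2# ^ (b ℕ.+ d) * (x * y) ^ n         ∎

  -- Choose `2# ^ b` above the inverse of `x ^ n` and multiply by `x ^ n`.
  power-bound-exists : ∀ {x} → 0# < x → ∀ n → ¬ ¬ ∃ λ b → 1# ≤ 2# ^ b * x ^ n
  power-bound-exists {x} 0<x n ∄b = 2^-unbounded w λ (b , w<2^b) → ∄b (b , (begin
    1#              ≈⟨ yw≈1 ⟨
    y * w           ≤⟨ *-monoʳ-≤ (proj₁ 0<y) (proj₁ w<2^b) ⟩
    y * 2# ^ b      ≈⟨ R.*-comm y _ ⟩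
    2# ^ b * y      ∎))
    where
    y : Carrier
    y = x ^ n
    0<y : 0# < y
    0<y = ^-positive n 0<x
    inv : ∃ λ w → y * w ≈ 1#
    inv = inverse (proj₂ 0<y ∘ R.sym)
    w : Carrier
    w = proj₁ inv
    yw≈1 : y * w ≈ 1#
    yw≈1 = proj₂ inv

  -- c - d is the integer part of log₂ (xⁿ).
  power-floor : ∀ {x} → 0# < x → ∀ n →
    ¬ ¬ ∃₂ λ c d → 2# ^ c ≤ 2# ^ d * x ^ n × 2# ^ d * x ^ n ≤ 2# ^ suc c
  power-floor {x} 0<x n ∄cd =
    power-bound-exists 0<x n λ (d , 1≤2^dx^n) →
    2^-unbounded (2# ^ d * x ^ n) λ (k , 2^dx^n<2^k) →
    let (c , p , ¬q) = switch-point (λ c → 2# ^ c ≤? 2# ^ d * x ^ n) 1≤2^dx^n k (<⇒≱ 2^dx^n<2^k)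
    in ∄cd (c , d , p , proj₁ (≰⇒> ¬q))

  -- From 2^a ≤ 2^b x^n ≤ 2^(k n + b), comparing exponents gives a ≤ k n + b, that is, (a - b) / n ≤
  -- k.
  2^-≤-bounded : ∀ {x} k → 0# ≤ x → x ≤ 2# ^ k → UpperBound (2^-≤ x) (ι k)
  2^-≤-bounded {x} k 0≤x x≤2^k {r} (a , b , q , eq , p) =
    *-cancelˡ-≤ (ι-positive q) (+-cancelʳ-≤ (ι b) (begin
      ι n * r + ι b     ≈⟨ +-congʳ (·≈ι* n r) ⟨
      n · r + ι b       ≈⟨ eq ⟩
      ι a               ≤⟨ ι-mono-≤ (2^-cancel-≤ {a} {k ℕ.* n ℕ.+ b} (begin
        2# ^ a                     ≤⟨ p ⟩
        2# ^ b * x ^ n             ≤⟨ *-monoʳ-≤ (proj₁ (0<2^ b)) (^-monoˡ-≤ n 0≤x x≤2^k) ⟩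
        2# ^ b * (2# ^ k) ^ n      ≈⟨ *-congˡ (^-assocʳ 2# k n) ⟩
        2# ^ b * 2# ^ (k ℕ.* n)    ≈⟨ R.*-comm _ _ ⟩
        2# ^ (k ℕ.* n) * 2# ^ b    ≈⟨ ^-homo-* 2# (k ℕ.* n) b ⟨
        2# ^ (k ℕ.* n ℕ.+ b)       ∎)) ⟩
      ι (k ℕ.* n ℕ.+ b)   ≈⟨ ι-homo-+ (k ℕ.* n) b ⟩
      ι (k ℕ.* n) + ι b   ≈⟨ +-congʳ (ι-homo-* k n) ⟩
      ι k * ι n + ι b     ≈⟨ +-congʳ (R.*-comm _ _) ⟩
      ι n * ι k + ι b     ∎))
    where n = suc q

  2^-≤-inhabited : ∀ {x} → 0# < x → ¬ ¬ ∃ (2^-≤ x)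
  2^-≤-inhabited 0<x ∄r = power-bound-exists 0<x 1 λ (b , p) →
    -- The witness is the integer -b: numerator 0 - b, and denominator 1 encoded as `q = 0`.
    let (r , eq) = quotient 0 0 b in ∄r (r , 0 , b , 0 , eq , p)

  -- `isSup` demands both an inhabitant and an upper bound. Here `r` is the inhabitant, and a power
  -- of two above `x` yields the bound up to double negation.
  ≤log₂ : ∀ {x r} → 0# < x → 2^-≤ x r → r ≤ log₂ x
  ≤log₂ {x} 0<x r∈ = ≤-stable λ r≰ → 2^-unbounded x λ (k , x<2^k) →
    r≰ (proj₁ (isSup (2^-≤ x) (_ , r∈)
      (ι k , 2^-≤-bounded k (proj₁ 0<x) (proj₁ x<2^k))) r∈)

  -- Here the bound is given, and the inhabitant is what exists only up to double negation.
  log₂≤ : ∀ {x u} → 0# < x → UpperBound (2^-≤ x) u → log₂ x ≤ u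
  log₂≤ {x} {u} 0<x bound = ≤-stable λ log≰ → 2^-≤-inhabited 0<x λ r∈ →
    log≰ (proj₂ (isSup (2^-≤ x) r∈ (u , bound)) bound)

  2^-≤-* : ∀ {x y z r s} → 0# ≤ x → 0# ≤ y → x * y ≤ z →
    2^-≤ x r → 2^-≤ y s → 2^-≤ z (r + s)
  2^-≤-* {x} {y} {z} {r} {s} 0≤x 0≤y xy≤z (a , b , q , r-eq , p) (c , d , l , s-eq , p′) =
    -- The fractions are added over the common denominator `n * m`. Since `n` and `m` are
    -- successors, `suc (l + q * m)` computes to `n * m`.
    a ℕ.* m ℕ.+ c ℕ.* n , b ℕ.* m ℕ.+ d ℕ.* n , l ℕ.+ q ℕ.* m , eq , (begin
      2# ^ (a ℕ.* m ℕ.+ c ℕ.* n)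
        ≤⟨ power-bound-* (a ℕ.* m) (b ℕ.* m) (c ℕ.* n) (d ℕ.* n) (n ℕ.* m)
             (power-bound-^ a b n m p)
             (≡.subst (λ k → 2# ^ (c ℕ.* n) ≤ 2# ^ (d ℕ.* n) * y ^ k) (ℕ.*-comm m n)
               (power-bound-^ c d m n p′)) ⟩
      2# ^ (b ℕ.* m ℕ.+ d ℕ.* n) * (x * y) ^ (n ℕ.* m)
        ≤⟨ *-monoʳ-≤ (proj₁ (0<2^ (b ℕ.* m ℕ.+ d ℕ.* n)))
             (^-monoˡ-≤ (n ℕ.* m) (*-nonNegative 0≤x 0≤y) xy≤z) ⟩
      2# ^ (b ℕ.* m ℕ.+ d ℕ.* n) * z ^ (n ℕ.* m) ∎)
    where
    n = suc q
    m = suc l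
    ι-homo : ∀ a c → ι (a ℕ.* m ℕ.+ c ℕ.* n) ≈ ι a * ι m + ι c * ι n
    ι-homo a c = R.trans (ι-homo-+ (a ℕ.* m) (c ℕ.* n)) (+-cong (ι-homo-* a m) (ι-homo-* c n))
    eq : (n ℕ.* m) · (r + s) + ι (b ℕ.* m ℕ.+ d ℕ.* n) ≈ ι (a ℕ.* m ℕ.+ c ℕ.* n)
    eq = begin-equality
      (n ℕ.* m) · (r + s) + ι (b ℕ.* m ℕ.+ d ℕ.* n)
        ≈⟨ +-cong (R.trans (·≈ι* (n ℕ.* m) (r + s)) (*-congʳ (ι-homo-* n m))) (ι-homo b d) ⟩
      (ι n * ι m) * (r + s) + (ι b * ι m + ι d * ι n)
        ≈⟨ solve 6 (λ n m r s b d → (n :* m) :* (r :+ s) :+ (b :* m :+ d :* n) :=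
             (n :* r :+ b) :* m :+ (m :* s :+ d) :* n) R.refl (ι n) (ι m) r s (ι b) (ι d) ⟩
      (ι n * r + ι b) * ι m + (ι m * s + ι d) * ι n
        ≈⟨ +-cong (*-congʳ (+-congʳ (·≈ι* n r))) (*-congʳ (+-congʳ (·≈ι* m s))) ⟨
      (n · r + ι b) * ι m + (m · s + ι d) * ι n
        ≈⟨ +-cong (*-congʳ r-eq) (*-congʳ s-eq) ⟩
      ι a * ι m + ι c * ι n
        ≈⟨ ι-homo a c ⟨
      ι (a ℕ.* m ℕ.+ c ℕ.* n) ∎

  -- Exponents for `x` and `y` add up to an exponent for `z`. The supremum is taken over `s` with
  -- `r` fixed, then over `r`. Admitting any `z` above `x * y` builds in the monotonicity of the
  -- logarithm.
  log₂-superadditive : ∀ {x y z} → 0# < x → 0# < y → x * y ≤ z → log₂ x + log₂ y ≤ log₂ z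
  log₂-superadditive {x} {y} {z} 0<x 0<y xy≤z =
    x≤z-y⇒x+y≤z (log₂≤ 0<x λ {r} r∈ → x+y≤z⇒x≤z-y (begin
      r + log₂ y   ≈⟨ R.+-comm r _ ⟩
      log₂ y + r   ≤⟨ x≤z-y⇒x+y≤z (log₂≤ 0<y λ {s} s∈ → x+y≤z⇒x≤z-y (begin
        s + r        ≈⟨ R.+-comm s r ⟩
        r + s        ≤⟨ ≤log₂ 0<z (2^-≤-* (proj₁ 0<x) (proj₁ 0<y) xy≤z r∈ s∈) ⟩
        log₂ z       ∎)) ⟩
      log₂ z       ∎))
    where
    0<z : 0# < z
    0<z = begin-strict
      0#      <⟨ *-positive 0<x 0<y ⟩
      x * y   ≤⟨ xy≤z ⟩
      z       ∎

  -- With n the denominator of r, the integer parts of log₂ (xⁿᴺ) and log₂ (yⁿᴺ) show that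
  -- N n r exceeds N n (log₂ x + log₂ y) by at most 2, for every N.
  2^-≤⇒≤log₂+log₂ : ∀ {x y r} → 0# < x → 0# < y → 2^-≤ (x * y) r → r ≤ log₂ x + log₂ y
  2^-≤⇒≤log₂+log₂ {x} {y} {r} 0<x 0<y (a , b , q , r-eq , p) =
    *-cancelˡ-≤ (ι-positive q) (begin
      -- A number whose positive multiples all stay below 2 is at most 0; here it is
      -- `ι n * r - ι n * L`.
      ι n * r          ≤⟨ x-y≤z⇒x≤z+y (bounded-multiples {u = 2#} multiple≤2) ⟩
      0# + ι n * L     ≈⟨ R.+-identityˡ _ ⟩
      ι n * L          ∎)
    where
    n = suc q
    L = log₂ x + log₂ y

    ι-homo : ∀ a c e → ι (a ℕ.+ (c ℕ.+ e)) ≈ ι a + (ι c + ι e)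
    ι-homo a c e = R.trans (ι-homo-+ a (c ℕ.+ e)) (+-congˡ (ι-homo-+ c e))

    2^-homo : ∀ a c e → 2# ^ (a ℕ.+ (c ℕ.+ e)) ≈ 2# ^ a * (2# ^ c * 2# ^ e)
    2^-homo a c e = R.trans (^-homo-* 2# a (c ℕ.+ e)) (*-congˡ (^-homo-* 2# c e))

    multiple≤2 : ∀ k → suc k · (ι n * r - ι n * L) ≤ 2#
    multiple≤2 k = ≤-stable λ ≰2 →
      power-floor 0<x m λ (c , d , x-lower , x-upper) →
      power-floor 0<y m λ (e , f , y-lower , y-upper) →
      -- The integer parts divided by `m` are rationals `u` and `v` below `log₂ x` and `log₂ y`.
      let (u , u-eq) = quotient m-1 c d
          (v , v-eq) = quotient m-1 e f
          u≤log = ≤log₂ 0<x (c , d , m-1 , u-eq , x-lower)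
          v≤log = ≤log₂ 0<y (e , f , m-1 , v-eq , y-lower)
          -- The bound for `x * y` is raised to the power `N` and multiplied by 2^(d + f); then the
          -- upper bounds for `x ^ m` and `y ^ m` apply. Each overshoots its integer part by one,
          -- whence the two successors.
          exponents : a ℕ.* N ℕ.+ (d ℕ.+ f) ℕ.≤ b ℕ.* N ℕ.+ (suc c ℕ.+ suc e)
          exponents = 2^-cancel-≤ (begin
            2# ^ (a ℕ.* N ℕ.+ (d ℕ.+ f))
              ≈⟨ 2^-homo (a ℕ.* N) d f ⟩
            2# ^ (a ℕ.* N) * (2# ^ d * 2# ^ f)
              ≤⟨ *-monoˡ-≤ (proj₁ (*-positive (0<2^ d) (0<2^ f))) (power-bound-^ a b n N p) ⟩
            2# ^ (b ℕ.* N) * (x * y) ^ m * (2# ^ d * 2# ^ f)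
              ≈⟨ *-congʳ (*-congˡ (^-distrib-* x y m)) ⟩
            2# ^ (b ℕ.* N) * (x ^ m * y ^ m) * (2# ^ d * 2# ^ f)
              ≈⟨ solve 5 (λ b x y d f → b :* (x :* y) :* (d :* f) :=
                   b :* ((d :* x) :* (f :* y))) R.refl
                   (2# ^ (b ℕ.* N)) (x ^ m) (y ^ m) (2# ^ d) (2# ^ f) ⟩
            2# ^ (b ℕ.* N) * ((2# ^ d * x ^ m) * (2# ^ f * y ^ m))
              ≤⟨ *-monoʳ-≤ (proj₁ (0<2^ (b ℕ.* N))) (*-mono-≤
                   (proj₁ (*-positive (0<2^ d) (^-positive m 0<x))) (proj₁ (0<2^ (suc e)))
                   x-upper y-upper) ⟩
            2# ^ (b ℕ.* N) * (2# ^ suc c * 2# ^ suc e)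
              ≈⟨ 2^-homo (b ℕ.* N) (suc c) (suc e) ⟨
            2# ^ (b ℕ.* N ℕ.+ (suc c ℕ.+ suc e)) ∎)
          -- The comparison of exponents read in the field: m r = (a - b) N, m u = c - d and m v = e
          -- - f. The two successors become `2#`.
          reals : ι m * r ≤ ι m * (u + v) + 2#
          reals = +-cancelʳ-≤ (ι b * ι N + (ι d + ι f)) (begin
            ι m * r + (ι b * ι N + (ι d + ι f))
              ≈⟨ +-congʳ (*-congʳ (ι-homo-* n N)) ⟩
            ι n * ι N * r + (ι b * ι N + (ι d + ι f))
              ≈⟨ solve 6 (λ n N r b d f → n :* N :* r :+ (b :* N :+ (d :+ f)) :=
                   (n :* r :+ b) :* N :+ (d :+ f)) R.refl (ι n) (ι N) r (ι b) (ι d) (ι f) ⟩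
            (ι n * r + ι b) * ι N + (ι d + ι f)
              ≈⟨ +-congʳ (*-congʳ (+-congʳ (·≈ι* n r))) ⟨
            (n · r + ι b) * ι N + (ι d + ι f)
              ≈⟨ +-congʳ (*-congʳ r-eq) ⟩
            ι a * ι N + (ι d + ι f)
              ≈⟨ +-congʳ (ι-homo-* a N) ⟨
            ι (a ℕ.* N) + (ι d + ι f)
              ≈⟨ ι-homo (a ℕ.* N) d f ⟨
            ι (a ℕ.* N ℕ.+ (d ℕ.+ f))
              ≤⟨ ι-mono-≤ exponents ⟩
            ι (b ℕ.* N ℕ.+ (suc c ℕ.+ suc e))
              ≈⟨ ι-homo (b ℕ.* N) (suc c) (suc e) ⟩
            ι (b ℕ.* N) + ((1# + ι c) + (1# + ι e))
              ≈⟨ +-cong (R.sym (ι-homo-* b N)) (+-cong (+-congˡ u-eq) (+-congˡ v-eq)) ⟨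
            ι b * ι N + ((1# + (m · u + ι d)) + (1# + (m · v + ι f)))
              ≈⟨ +-congˡ (+-cong (+-congˡ (+-congʳ (·≈ι* m u))) (+-congˡ (+-congʳ (·≈ι* m v)))) ⟩
            ι b * ι N + ((1# + (ι m * u + ι d)) + (1# + (ι m * v + ι f)))
              ≈⟨ solve 7 (λ bN i m u v d f →
                   bN :+ ((i :+ (m :* u :+ d)) :+ (i :+ (m :* v :+ f))) :=
                   (m :* (u :+ v) :+ (i :+ i)) :+ (bN :+ (d :+ f)))
                   R.refl (ι b * ι N) 1# (ι m) u v (ι d) (ι f) ⟩
            (ι m * (u + v) + 2#) + (ι b * ι N + (ι d + ι f)) ∎)
      in ≰2 (begin
        N · (ι n * r - ι n * L)           ≈⟨ ·≈ι* N _ ⟩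
        ι N * (ι n * r - ι n * L)         ≈⟨ x[y-z]≈xy-xz (ι N) _ _ ⟩
        ι N * (ι n * r) - ι N * (ι n * L)
          ≤⟨ x≤z+y⇒x-y≤z (begin
            ι N * (ι n * r)                ≈⟨ ιN[ιn*]≈ιm* r ⟩
            ι m * r                        ≤⟨ reals ⟩
            ι m * (u + v) + 2#             ≤⟨ +-monoˡ-≤ 2# (*-monoʳ-≤ (ι-nonNegative m)
                                                (+-mono-≤ u≤log v≤log)) ⟩
            ι m * L + 2#                   ≈⟨ R.+-comm _ 2# ⟩
            2# + ι m * L                   ≈⟨ +-congˡ (ιN[ιn*]≈ιm* L) ⟨
            2# + ι N * (ι n * L)           ∎) ⟩
        2#                                 ∎)
      where
      N = suc k
      m = n ℕ.* N
      -- `suc m-1` computes to `m`, because `n` and `N` are successors.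
      m-1 = k ℕ.+ q ℕ.* N
      ιN[ιn*]≈ιm* : ∀ z → ι N * (ι n * z) ≈ ι m * z
      ιN[ιn*]≈ιm* z = begin-equality
        ι N * (ι n * z)   ≈⟨ solve 3 (λ N n z → N :* (n :* z) := n :* N :* z) R.refl (ι N) (ι n) z ⟩
        ι n * ι N * z     ≈⟨ *-congʳ (ι-homo-* n N) ⟨
        ι m * z           ∎

  log₂-subadditive : ∀ {x y} → 0# < x → 0# < y → log₂ (x * y) ≤ log₂ x + log₂ y
  log₂-subadditive 0<x 0<y = log₂≤ (*-positive 0<x 0<y) (2^-≤⇒≤log₂+log₂ 0<x 0<y)

-- Finite sums and extrema.

module FiniteSums {ℓ} (ℝ : CompleteOrderedField ℓ) where
  open CompleteOrderedField ℝ
  open Leakage ℝ using (sumList; maximum; minimum; maxOver)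
  open OrderedField ℝ
  open R using (+-cong; +-congˡ; +-congʳ)
  open SemiringSolver R.commutativeSemiring using (solve; _:=_; _:+_; _:*_)
  open PartialOrderReasoning O.poset

  module _ {A : Set} where
    ∑ : (A → Carrier) → List A → Carrier
    ∑ f xs = sumList (map f xs)

    ∑-mono-≤ : ∀ {f g} → (∀ x → f x ≤ g x) → ∀ xs → ∑ f xs ≤ ∑ g xs
    ∑-mono-≤ f≤g []       = O.refl
    ∑-mono-≤ f≤g (x ∷ xs) = +-mono-≤ (f≤g x) (∑-mono-≤ f≤g xs)

    ∑-cong : ∀ {f g} → (∀ x → f x ≈ g x) → ∀ xs → ∑ f xs ≈ ∑ g xs
    ∑-cong f≈g []       = R.refl
    ∑-cong f≈g (x ∷ xs) = +-cong (f≈g x) (∑-cong f≈g xs)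

    ∑-nonNegative : ∀ {f} → (∀ x → 0# ≤ f x) → ∀ xs → 0# ≤ ∑ f xs
    ∑-nonNegative 0≤f []       = O.refl
    ∑-nonNegative 0≤f (x ∷ xs) = +-nonNegative (0≤f x) (∑-nonNegative 0≤f xs)

    ∑-zero : ∀ xs → ∑ (λ _ → 0#) xs ≈ 0#
    ∑-zero []       = R.refl
    ∑-zero (x ∷ xs) = R.trans (R.+-identityˡ _) (∑-zero xs)

    ∑-distribˡ : ∀ c f xs → ∑ (λ x → c * f x) xs ≈ c * ∑ f xs
    ∑-distribˡ c f []       = R.sym (R.zeroʳ c)
    ∑-distribˡ c f (x ∷ xs) = R.trans (+-congˡ (∑-distribˡ c f xs)) (R.sym (R.distribˡ c _ _))

    ∑-+ : ∀ f g xs → ∑ (λ x → f x + g x) xs ≈ ∑ f xs + ∑ g xs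
    ∑-+ f g []       = R.sym (R.+-identityˡ 0#)
    ∑-+ f g (x ∷ xs) = R.trans (+-congˡ (∑-+ f g xs))
      (solve 4 (λ a b c d → (a :+ b) :+ (c :+ d) := (a :+ c) :+ (b :+ d)) R.refl _ _ _ _)

    ∑-++ : ∀ f xs ys → ∑ f (xs ++ ys) ≈ ∑ f xs + ∑ f ys
    ∑-++ f []       ys = R.sym (R.+-identityˡ _)
    ∑-++ f (x ∷ xs) ys = R.trans (+-congˡ (∑-++ f xs ys)) (R.sym (R.+-assoc _ _ _))

    -- Expanding the right side gives the diagonal terms and cross terms. Each induction step adds
    -- the nonnegative cross terms between head and tail.
    ∑-*-≤ : ∀ {f g} → (∀ x → 0# ≤ f x) → (∀ x → 0# ≤ g x) → ∀ xs →
      ∑ (λ x → f x * g x) xs ≤ ∑ f xs * ∑ g xs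
    ∑-*-≤ 0≤f 0≤g [] = O.reflexive (R.sym (R.zeroˡ 0#))
    ∑-*-≤ {f} {g} 0≤f 0≤g (x ∷ xs) = begin
      f x * g x + ∑ (λ x → f x * g x) xs
        ≤⟨ +-monoʳ-≤ _ (∑-*-≤ 0≤f 0≤g xs) ⟩
      f x * g x + F * G
        ≈⟨ R.+-identityʳ _ ⟨
      f x * g x + F * G + 0#
        ≤⟨ +-monoʳ-≤ _ (+-nonNegative (*-nonNegative (0≤f x) (∑-nonNegative 0≤g xs))
             (*-nonNegative (∑-nonNegative 0≤f xs) (0≤g x))) ⟩
      f x * g x + F * G + (f x * G + F * g x)
        ≈⟨ solve 4 (λ a b F G → a :* b :+ F :* G :+ (a :* G :+ F :* b) :=
             (a :+ F) :* (b :+ G)) R.refl (f x) (g x) F G ⟩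
      (f x + F) * (g x + G) ∎
      where
      F = ∑ f xs
      G = ∑ g xs

  ∑-map : ∀ {A B : Set} (f : B → Carrier) (h : A → B) xs → ∑ f (map h xs) ≈ ∑ (f ∘ h) xs
  ∑-map f h []       = R.refl
  ∑-map f h (x ∷ xs) = +-congˡ (∑-map f h xs)

  ∑-swap : ∀ {A B : Set} (f : A → B → Carrier) xs ys →
    ∑ (λ x → ∑ (f x) ys) xs ≈ ∑ (λ y → ∑ (λ x → f x y) xs) ys
  ∑-swap f []       ys = R.sym (∑-zero ys)
  ∑-swap f (x ∷ xs) ys = R.trans (+-congˡ (∑-swap f xs ys)) (R.sym (∑-+ (f x) _ ys))

  ∑-cartesianProduct : ∀ {A B : Set} (f : A → Carrier) (g : B → Carrier) xs ys →
    ∑ (λ (x , y) → f x * g y) (cartesianProduct xs ys) ≈ ∑ f xs * ∑ g ys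
  ∑-cartesianProduct f g []       ys = R.sym (R.zeroˡ _)
  ∑-cartesianProduct f g (x ∷ xs) ys = begin-equality
    ∑ h (map (x ,_) ys ++ cartesianProduct xs ys)         ≈⟨ ∑-++ h (map (x ,_) ys) _ ⟩
    ∑ h (map (x ,_) ys) + ∑ h (cartesianProduct xs ys)    ≈⟨ +-cong (∑-map h (x ,_) ys)
                                                             (∑-cartesianProduct f g xs ys) ⟩
    ∑ (λ y → f x * g y) ys + ∑ f xs * ∑ g ys              ≈⟨ +-congʳ (∑-distribˡ (f x) g ys) ⟩
    f x * ∑ g ys + ∑ f xs * ∑ g ys                        ≈⟨ R.distribʳ _ _ _ ⟨
    (f x + ∑ f xs) * ∑ g ys                               ∎
    where
    h : _ → Carrier
    h (x , y) = f x * g y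

  ≤maximum : ∀ {v} vs → v ∈ vs → v ≤ maximum vs
  ≤maximum (v ∷ vs) (here ≡.refl) = Extrema.⊥≤max O.totalOrder v vs
  ≤maximum (v ∷ vs) (there v∈)    = All.lookup (Extrema.xs≤max O.totalOrder v vs) v∈

  minimum≤ : ∀ {v} vs → v ∈ vs → minimum vs ≤ v
  minimum≤ (v ∷ vs) (here ≡.refl) = Extrema.min≤⊤ O.totalOrder v vs
  minimum≤ (v ∷ vs) (there v∈)    = All.lookup (Extrema.min≤xs O.totalOrder v vs) v∈

  -- The empty list is excluded because `minimum` defaults to `0#` there.
  minimum-positive : ∀ vs → ¬ vs ≡ [] → All (0# <_) vs → 0# < minimum vs
  minimum-positive []       vs≢[] _            = ⊥-elim (vs≢[] ≡.refl)
  minimum-positive (v ∷ vs) _     (0<v ∷ 0<vs) = Extrema.v<min⁺ O.totalOrder 0<v 0<vs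

  module _ (X : FiniteSet) where
    ≤maxOver : ∀ f x → f x ≤ maxOver X f
    ≤maxOver f x = ≤maximum _ (∈-map⁺ f (FiniteSet.complete X x))

    -- P 0# accounts for the value of maxOver on an empty set.
    maxOver-elim : ∀ {p} (P : Pred Carrier p) f → P 0# → (∀ x → P (f x)) → P (maxOver X f)
    maxOver-elim P f P0 Pf with elements X
    ... | []     = P0
    ... | x ∷ xs =
      Extrema.argmax-all O.totalOrder (λ v → v) {P = P} (Pf x) (All.map⁺ (All.universal Pf xs))

-- Bounds on the posterior gain.

module GainLeakage {ℓ} (ℝ : CompleteOrderedField ℓ) {W X : FiniteSet}
  (g : Leakage.GainFunction ℝ W X) (π : Leakage.Prior ℝ X) where
  open CompleteOrderedField ℝ
  open Leakage ℝ
  open OrderedField ℝ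
  open FiniteSums ℝ
  open R using (*-congˡ)
  open SemiringSolver R.commutativeSemiring using (solve; _:=_; _:*_)
  open DecTotalOrderProperties decTotalOrder using (<⇒≱)
  open PartialOrderReasoning O.poset

  joint : ∣ W ∣ → ∣ X ∣ → Carrier
  joint w x = π [ x ] * gain g w x

  joint-nonNegative : ∀ w x → 0# ≤ joint w x
  joint-nonNegative w x =
    *-nonNegative (Distribution.nonNegative π x) (GainFunction.nonNegative g w x)

  values nonzeroValues : List Carrier
  values        = map (λ (x , w) → joint w x) (elements (X ×ᶠ W))
  nonzeroValues = filter (λ v → ¬? (v ≟ 0#)) values

  -- `minH g π` unfolds to `- log₂ least`.
  least : Carrier
  least = minimum nonzeroValues

  joint∈values : ∀ w x → joint w x ∈ values
  joint∈values w x = ∈-map⁺ _ (FiniteSet.complete (X ×ᶠ W) (x , w))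

  joint∈nonzeroValues : ∀ w x → ¬ joint w x ≈ 0# → joint w x ∈ nonzeroValues
  joint∈nonzeroValues w x = ∈-filter⁺ (λ v → ¬? (v ≟ 0#)) (joint∈values w x)

  -- Were there no nonzero joint value, every expected gain would be zero, contradicting
  -- `0# < priorV g π`. The listed values are nonnegative and nonzero, hence positive.
  least-positive : 0# < priorV g π → 0# < least
  least-positive 0<V = minimum-positive nonzeroValues nonempty positive
    where
    positive : All (0# <_) nonzeroValues
    positive = All.zipWith (λ (0≤v , v≉0) → 0≤v , v≉0 ∘ R.sym)
      ( All.filter⁺ (λ v → ¬? (v ≟ 0#)) (All.map⁺
          (All.universal (λ (x , w) → joint-nonNegative w x) (elements (X ×ᶠ W))))
      , All.all-filter (λ v → ¬? (v ≟ 0#)) values)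

    nonempty : ¬ nonzeroValues ≡ []
    nonempty ≡[] = <⇒≱ 0<V (maxOver-elim W (_≤ 0#) _ O.refl λ w → begin
      ∑ (joint w) (elements X)    ≈⟨ ∑-cong (joint≈0 w) (elements X) ⟩
      ∑ (λ _ → 0#) (elements X)   ≈⟨ ∑-zero (elements X) ⟩
      0#                          ∎)
      where
      joint≈0 : ∀ w x → joint w x ≈ 0#
      joint≈0 w x = decidable-stable (joint w x ≟ 0#) λ ≉0 →
        contradiction (≡.subst (joint w x ∈_) ≡[] (joint∈nonzeroValues w x ≉0)) λ ()

  -- A zero value makes both sides vanish, so the estimate covers all `x` and can be summed.
  least*joint≤ : ∀ w x → least * joint w x ≤ joint w x * joint w x
  least*joint≤ w x with joint w x ≟ 0#
  ... | yes ≈0 = O.reflexive (R.trans (*-congˡ ≈0) (R.trans (R.zeroʳ least)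
                   (R.sym (R.trans (*-congˡ ≈0) (R.zeroʳ (joint w x))))))
  ... | no  ≉0 = *-monoˡ-≤ (joint-nonNegative w x)
                   (minimum≤ nonzeroValues (joint∈nonzeroValues w x ≉0))

  module _ {Y : FiniteSet} (C : Channel X Y) where
    score : ∣ Y ∣ → ∣ W ∣ → ∣ X ∣ → Carrier
    score y w x = π [ x ] * matrix C x y * gain g w x

    bestScore : ∣ Y ∣ → Carrier
    bestScore y = maxOver W λ w → ∑ (score y w) (elements X)

    score-nonNegative : ∀ y w x → 0# ≤ score y w x
    score-nonNegative y w x = *-nonNegative
      (*-nonNegative (Distribution.nonNegative π x) (Channel.nonNegative C x y))
      (GainFunction.nonNegative g w x)

    ∑score-nonNegative : ∀ y w → 0# ≤ ∑ (score y w) (elements X)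
    ∑score-nonNegative y w = ∑-nonNegative (score-nonNegative y w) (elements X)

    bestScore-nonNegative : ∀ y → 0# ≤ bestScore y
    bestScore-nonNegative y = maxOver-elim W (0# ≤_) _ O.refl (∑score-nonNegative y)

    -- Since the rows of `C` sum to 1, using one fixed `w` for every output `y` earns its prior
    -- gain; choosing the best `w` for each `y` earns at least that.
    priorV≤posteriorV : priorV g π ≤ posteriorV g π C
    priorV≤posteriorV = maxOver-elim W (_≤ posteriorV g π C) _
      (∑-nonNegative bestScore-nonNegative (elements Y)) λ w → begin
      ∑ (joint w) (elements X)
        ≈⟨ ∑-cong (row w) (elements X) ⟨
      ∑ (λ x → ∑ (λ y → score y w x) (elements Y)) (elements X)
        ≈⟨ ∑-swap (λ x y → score y w x) (elements X) (elements Y) ⟩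
      ∑ (λ y → ∑ (score y w) (elements X)) (elements Y)
        ≤⟨ ∑-mono-≤ (λ y → ≤maxOver W (λ w → ∑ (score y w) (elements X)) w) (elements Y) ⟩
      posteriorV g π C ∎
      where
      row : ∀ w x → ∑ (λ y → score y w x) (elements Y) ≈ joint w x
      row w x = begin-equality
        ∑ (λ y → score y w x) (elements Y)
          ≈⟨ ∑-cong (λ y → solve 3 (λ p c g → p :* c :* g := (p :* g) :* c) R.refl _ _ _) (elements Y) ⟩
        ∑ (λ y → joint w x * matrix C x y) (elements Y)
          ≈⟨ ∑-distribˡ (joint w x) (matrix C x) (elements Y) ⟩
        joint w x * ∑ (matrix C x) (elements Y)
          ≈⟨ *-congˡ (Channel.rowSum≈1 C x) ⟩
        joint w x * 1#
          ≈⟨ R.*-identityʳ _ ⟩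
        joint w x ∎

    posteriorV-positive : 0# < priorV g π → 0# < posteriorV g π C
    posteriorV-positive 0<V = begin-strict
      0#                 <⟨ 0<V ⟩
      priorV g π         ≤⟨ priorV≤posteriorV ⟩
      posteriorV g π C   ∎

  module _ {Y₁ Y₂ : FiniteSet} (C₁ : Channel X Y₁) (C₂ : Channel X Y₂) where
    -- Prior and gain enter the left score once but the product on the right twice. The factor
    -- `least` makes up for the second `joint w x`.
    score-∥-≤ : ∀ y₁ y₂ w x →
      least * score (C₁ ∥ C₂) (y₁ , y₂) w x ≤ score C₁ y₁ w x * score C₂ y₂ w x
    score-∥-≤ y₁ y₂ w x = begin
      least * (p * (c₁ * c₂) * v)
        ≈⟨ solve 5 (λ m p c d v → m :* (p :* (c :* d) :* v) := (m :* (p :* v)) :* (c :* d))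
             R.refl least p c₁ c₂ v ⟩
      least * joint w x * (c₁ * c₂)
        ≤⟨ *-monoˡ-≤ (*-nonNegative (Channel.nonNegative C₁ x y₁) (Channel.nonNegative C₂ x y₂))
             (least*joint≤ w x) ⟩
      joint w x * joint w x * (c₁ * c₂)
        ≈⟨ solve 4 (λ p c d v → (p :* v) :* (p :* v) :* (c :* d) := (p :* c :* v) :* (p :* d :* v))
             R.refl p c₁ c₂ v ⟩
      score C₁ y₁ w x * score C₂ y₂ w x ∎
      where
      p  = π [ x ]
      c₁ = matrix C₁ x y₁
      c₂ = matrix C₂ x y₂
      v  = gain g w x

    bestScore-∥-≤ : ∀ y₁ y₂ →
      least * bestScore (C₁ ∥ C₂) (y₁ , y₂) ≤ bestScore C₁ y₁ * bestScore C₂ y₂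
    bestScore-∥-≤ y₁ y₂ = maxOver-elim W (λ s → least * s ≤ B₁ * B₂) _
      (O.trans (O.reflexive (R.zeroʳ least)) (*-nonNegative 0≤B₁ 0≤B₂)) λ w → begin
      least * ∑ (score (C₁ ∥ C₂) (y₁ , y₂) w) xs
        ≈⟨ ∑-distribˡ least _ xs ⟨
      ∑ (λ x → least * score (C₁ ∥ C₂) (y₁ , y₂) w x) xs
        ≤⟨ ∑-mono-≤ (score-∥-≤ y₁ y₂ w) xs ⟩
      ∑ (λ x → score C₁ y₁ w x * score C₂ y₂ w x) xs
        ≤⟨ ∑-*-≤ (score-nonNegative C₁ y₁ w) (score-nonNegative C₂ y₂ w) xs ⟩
      ∑ (score C₁ y₁ w) xs * ∑ (score C₂ y₂ w) xs
        -- The common `w` is replaced by a best choice for each channel separately.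
        ≤⟨ *-mono-≤ (∑score-nonNegative C₁ y₁ w) 0≤B₂
             (≤maxOver W (λ w → ∑ (score C₁ y₁ w) xs) w)
             (≤maxOver W (λ w → ∑ (score C₂ y₂ w) xs) w) ⟩
      B₁ * B₂ ∎
      where
      xs = elements X
      B₁ = bestScore C₁ y₁
      B₂ = bestScore C₂ y₂
      0≤B₁ : 0# ≤ B₁
      0≤B₁ = bestScore-nonNegative C₁ y₁
      0≤B₂ : 0# ≤ B₂
      0≤B₂ = bestScore-nonNegative C₂ y₂

    posteriorV-∥-≤ : least * posteriorV g π (C₁ ∥ C₂) ≤ posteriorV g π C₁ * posteriorV g π C₂
    posteriorV-∥-≤ = begin
      least * ∑ (bestScore (C₁ ∥ C₂)) ys
        ≈⟨ ∑-distribˡ least (bestScore (C₁ ∥ C₂)) ys ⟨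
      ∑ (λ y → least * bestScore (C₁ ∥ C₂) y) ys
        ≤⟨ ∑-mono-≤ (λ (y₁ , y₂) → bestScore-∥-≤ y₁ y₂) ys ⟩
      ∑ (λ (y₁ , y₂) → bestScore C₁ y₁ * bestScore C₂ y₂) ys
        -- The bound is a product of a term in `y₁` and a term in `y₂`, so the sum over pairs
        -- factors.
        ≈⟨ ∑-cartesianProduct (bestScore C₁) (bestScore C₂) (elements Y₁) (elements Y₂) ⟩
      posteriorV g π C₁ * posteriorV g π C₂ ∎
      where ys = elements (Y₁ ×ᶠ Y₂)

-- Passage to entropies.

theorem3p12 : ∀ {ℓ} (ℝ : CompleteOrderedField ℓ) →
    let open CompleteOrderedField ℝ
        open Leakage ℝ
    in (X Y₁ Y₂ W : FiniteSet) →
       Nonempty X → Nonempty Y₁ → Nonempty Y₂ → Nonempty W →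
       (g : GainFunction W X) (π : Prior X) →
       0# < priorV g π →
       (C₁ : Channel X Y₁) (C₂ : Channel X Y₂) →
       posteriorH g π (C₁ ∥ C₂) ≥ (posteriorH g π C₁ + posteriorH g π C₂) - minH g π
theorem3p12 ℝ _ _ _ _ _ _ _ _ g π 0<V C₁ C₂ = begin
  (- log₂ V₁ - log₂ V₂) - (- log₂ least)
    ≈⟨ R.+-cong (⁻¹-∙-comm (log₂ V₁) (log₂ V₂)) (⁻¹-involutive (log₂ least)) ⟩
  - (log₂ V₁ + log₂ V₂) + log₂ least
    ≤⟨ +-monoˡ-≤ (log₂ least) (-‿anti-≤ logs) ⟩
  - (log₂ least + log₂ V) + log₂ least
    ≈⟨ R.+-congʳ (⁻¹-∙-comm (log₂ least) (log₂ V)) ⟨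
  (- log₂ least - log₂ V) + log₂ least
    ≈⟨ R.+-congʳ (R.+-comm (- log₂ least) (- log₂ V)) ⟩
  (- log₂ V - log₂ least) + log₂ least
    ≈⟨ x-y+y≈x (- log₂ V) (log₂ least) ⟩
  - log₂ V ∎
  where
  open CompleteOrderedField ℝ
  open Leakage ℝ
  open OrderedField ℝ
  open Logarithm ℝ
  open GainLeakage ℝ g π
  open AbelianGroupProperties R.+-abelianGroup using (⁻¹-∙-comm; ⁻¹-involutive)
  open PartialOrderReasoning O.poset
  V₁ V₂ V : Carrier
  V₁ = posteriorV g π C₁
  V₂ = posteriorV g π C₂
  V  = posteriorV g π (C₁ ∥ C₂)
  logs : log₂ least + log₂ V ≤ log₂ V₁ + log₂ V₂
  -- Superadditivity is applied with `z` equal to `V₁ * V₂`; subadditivity then splits the logarithm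
  -- of that product.
  logs = O.trans
    (log₂-superadditive (least-positive 0<V) (posteriorV-positive (C₁ ∥ C₂) 0<V)
      (posteriorV-∥-≤ C₁ C₂))
    (log₂-subadditive (posteriorV-positive C₁ 0<V) (posteriorV-positive C₂ 0<V))
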